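{- Let $(\mathcal{S}^x,H)$ be a finite thick EGQ of order $(t^2,t)$ satisfying property (*). Then $(\mathcal{S}^x,H)$ is an STGQ; in particular, $x$ is a regular point.
   Context: A finite GQ of order $(s,t)$: every line has $s+1$ points, every point lies on $t+1$ lines, and for each point $p$ and line $L$ not through $p$ exactly one point of $L$ is collinear with $p$; thick means $s,t\ge2$. An EGQ $(\mathcal{S}^x,H)$: $H\le\mathrm{Aut}(\mathcal{S})$ fixes every line through $x$ and acts sharply transitively on the points not collinear with $x$. A symmetry with center $x$ fixes every point collinear with $x$; an STGQ is an EGQ of order $(s,t)$ whose elation group contains a group of $t$ symmetries with center $x$. Property (*): whenever an element of $H$ fixes a point $y\ne x$ collinear with $x$, it fixes every point of $xy$. For points $p,q$ let $\{p,q\}^\perp$ be the set of points collinear with both, and $\{p,q\}^{\perp\perp}$ the set of points collinear with all points of $\{p,q\}^\perp$; $x$ is regular if $|\{x,y\}^{\perp\perp}|=t+1$ for every point $y$ not collinear with $x$. -}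

module Defs where

open import Data.Nat using (ℕ; zero; suc; _+_; _*_; _≤_)
open import Data.Bool using (Bool; true; false; _∧_; _∨_; not; if_then_else_)
open import Data.Fin using (Fin; zero; suc)
open import Data.Product using (Σ; _×_; _,_; ∃)
open import Relation.Binary.PropositionalEquality using (_≡_; refl; sym; trans; cong; cong₂)
open import Relation.Nullary using (¬_)

count : ∀ {n} → (Fin n → Bool) → ℕ
count {zero} f = 0
count {suc n} f = (if f zero then 1 else 0) + count (λ i → f (suc i))

anyF : ∀ {n} → (Fin n → Bool) → Bool
anyF {zero} f = false
anyF {suc n} f = f zero ∨ anyF (λ i → f (suc i))

allF : ∀ {n} → (Fin n → Bool) → Bool
allF {zero} f = true
allF {suc n} f = f zero ∧ allF (λ i → f (suc i))

module _ {nP nL : ℕ} (I : Fin nP → Fin nL → Bool) where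

  col : Fin nP → Fin nP → Bool
  col p q = anyF (λ L → I p L ∧ I q L)

  -- Generalized quadrangle of order (s,t) (Payne–Thas definition).
  record IsGQ (s t : ℕ) : Set where
    field
      linePts   : ∀ L → count (λ p → I p L) ≡ suc s
      ptLines   : ∀ p → count (λ L → I p L) ≡ suc t
      partial   : ∀ p q L M → ¬ (p ≡ q) → I p L ≡ true → I q L ≡ true →
                  I p M ≡ true → I q M ≡ true → L ≡ M
      gqAxiom   : ∀ p L → I p L ≡ false →
                  count (λ q → I q L ∧ col p q) ≡ 1

  record Aut : Set where
    field
      pf pg : Fin nP → Fin nP
      lf lg : Fin nL → Fin nL
      pfg : ∀ p → pf (pg p) ≡ p
      pgf : ∀ p → pg (pf p) ≡ p
      lfg : ∀ L → lf (lg L) ≡ L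
      lgf : ∀ L → lg (lf L) ≡ L
      inc : ∀ p L → I (pf p) (lf L) ≡ I p L
  open Aut public

  _≈A_ : Aut → Aut → Set
  g ≈A h = (∀ p → pf g p ≡ pf h p) × (∀ L → lf g L ≡ lf h L)

  idA : Aut
  idA = record { pf = λ p → p ; pg = λ p → p ; lf = λ L → L ; lg = λ L → L
               ; pfg = λ _ → refl ; pgf = λ _ → refl ; lfg = λ _ → refl ; lgf = λ _ → refl
               ; inc = λ _ _ → refl }

  _∘A_ : Aut → Aut → Aut
  g ∘A h = record
    { pf = λ p → pf g (pf h p) ; pg = λ p → pg h (pg g p)
    ; lf = λ L → lf g (lf h L) ; lg = λ L → lg h (lg g L)
    ; pfg = λ p → trans (cong (pf g) (pfg h (pg g p))) (pfg g p)
    ; pgf = λ p → trans (cong (pg h) (pgf g (pf h p))) (pgf h p)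
    ; lfg = λ L → trans (cong (lf g) (lfg h (lg g L))) (lfg g L)
    ; lgf = λ L → trans (cong (lg h) (lgf g (lf h L))) (lgf h L)
    ; inc = λ p L → trans (inc g (pf h p) (lf h L)) (inc h p L) }

  invA : Aut → Aut
  invA g = record
    { pf = pg g ; pg = pf g ; lf = lg g ; lg = lf g
    ; pfg = pgf g ; pgf = pfg g ; lfg = lgf g ; lgf = lfg g
    ; inc = λ p L → trans (sym (inc g (pg g p) (lg g L)))
                          (cong₂ I (pfg g p) (lfg g L)) }

  record IsSubgroup (H : Aut → Set) : Set where
    field
      respects : ∀ g h → g ≈A h → H g → H h
      hasId    : H idA
      closedComp : ∀ g h → H g → H h → H (g ∘A h)
      closedInv  : ∀ g → H g → H (invA g)

  record IsEGQ (s t : ℕ) (x : Fin nP) (H : Aut → Set) : Set where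
    field
      gq        : IsGQ s t
      subgroup  : IsSubgroup H
      fixLines  : ∀ h → H h → ∀ L → I x L ≡ true → lf h L ≡ L
      transitive : ∀ y z → col x y ≡ false → col x z ≡ false →
                   Σ Aut (λ h → H h × (pf h y ≡ z))
      sharp     : ∀ y h h' → col x y ≡ false → H h → H h' →
                  pf h y ≡ pf h' y → h ≈A h'

  IsSymmetry : Fin nP → Aut → Set
  IsSymmetry x θ = ∀ p → col x p ≡ true → pf θ p ≡ p

  PropertyStar : Fin nP → (Aut → Set) → Set
  PropertyStar x H = ∀ h → H h → ∀ y → ¬ (y ≡ x) → col x y ≡ true →
                     pf h y ≡ y →
                     ∀ L → I x L ≡ true → I y L ≡ true →
                     ∀ z → I z L ≡ true → pf h z ≡ z

  -- STGQ: an EGQ whose elation group contains a group of t symmetries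
  -- with center x (a family of t pairwise distinct elements of H, all
  -- symmetries about x, containing the identity and closed under
  -- composition and inversion).
  IsSTGQ : (s t : ℕ) → Fin nP → (Aut → Set) → Set
  IsSTGQ s t x H =
    IsEGQ s t x H ×
    Σ (Fin t → Aut) (λ θ →
      (∀ i → H (θ i)) ×
      (∀ i → IsSymmetry x (θ i)) ×
      (∀ i j → θ i ≈A θ j → i ≡ j) ×
      (Σ (Fin t) (λ k → θ k ≈A idA)) ×
      (∀ i j → Σ (Fin t) (λ k → (θ i ∘A θ j) ≈A θ k)) ×
      (∀ i → Σ (Fin t) (λ k → invA (θ i) ≈A θ k)))

  perp : Fin nP → Fin nP → Fin nP → Bool
  perp p q z = col p z ∧ col q z

  perpperp : Fin nP → Fin nP → Fin nP → Bool
  perpperp p q z = allF (λ w → not (perp p q w) ∨ col w z)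

  IsRegular : ℕ → Fin nP → Set
  IsRegular t x = ∀ y → col x y ≡ false → count (perpperp x y) ≡ suc t

{-# OPTIONS --safe #-}
-- In a quadrangle of order (t², t) every triad of lines has exactly t + 1 centers, by equality in
-- Higman's inequality.  Let h ≠ 1 in H fix two lines L and M on x pointwise.  If h moved a point r of
-- a third line N on x, then for a line R ≠ N on r the triad {R, hR, L} would have N as its only center:
-- another center S would meet R, hR and L in a, ha and a fixed point, hence be fixed by h, and the
-- projection onto S of a point of M would be a fixed point opposite x.  So h is a symmetry.
-- For a on L and b on M the elements of H taking one point of {a,b}^⊥ other than x to another fix
-- a and b, hence L and M pointwise by (*): they are the t symmetries, and they show that
-- {x,y}^⊥⊥ = {a,b}^⊥ when a and b are the projections of y.
module Submission where

open import Defs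
open import Data.Bool using (Bool; true; false; _∧_; _∨_; not)
open import Data.Bool.Properties using (∧-conicalˡ; ∧-conicalʳ; ¬-not)
open import Data.Empty using (⊥; ⊥-elim)
open import Data.Fin using (Fin; zero; suc; _≟_; punchIn; punchOut)
open import Data.Fin.Properties using (suc-injective; 0≢1+n; punchIn-injective; punchInᵢ≢i; punchIn-punchOut)
open import Data.Nat as ℕ using (ℕ; zero; suc; z≤n)
open import Data.Integer using (ℤ; +_; 0ℤ; 1ℤ)
import Data.Nat.Properties as ℕₚ
import Data.Integer.Properties as ℤₚ
open import Data.Product using (Σ; ∃; _×_; _,_; proj₁; proj₂)
open import Data.Sum using (_⊎_; inj₁; inj₂; [_,_]′)
open import Function using (_∘_)
open import Relation.Nullary using (¬_; Dec; yes; no)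
open import Relation.Nullary.Decidable using (⌊_⌋)
open import Relation.Binary.PropositionalEquality

-- Boolean predicates and counting on finite sets.

false≢true : false ≢ true
false≢true ()

anyF⇒∃ : ∀ {n} (f : Fin n → Bool) → anyF f ≡ true → ∃ λ i → f i ≡ true
anyF⇒∃ {suc n} f h with f zero in eq
... | true  = zero , eq
... | false = let i , p = anyF⇒∃ (f ∘ suc) h in suc i , p

∃⇒anyF : ∀ {n} (f : Fin n → Bool) i → f i ≡ true → anyF f ≡ true
∃⇒anyF f zero p rewrite p = refl
∃⇒anyF f (suc i) p with f zero
... | true  = refl
... | false = ∃⇒anyF (f ∘ suc) i p

allF⇒∀ : ∀ {n} (f : Fin n → Bool) → allF f ≡ true → ∀ i → f i ≡ true
allF⇒∀ f h zero    = ∧-conicalˡ (f zero) _ h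
allF⇒∀ f h (suc i) = allF⇒∀ (f ∘ suc) (∧-conicalʳ (f zero) _ h) i

∀⇒allF : ∀ {n} (f : Fin n → Bool) → (∀ i → f i ≡ true) → allF f ≡ true
∀⇒allF {zero}  f h = refl
∀⇒allF {suc n} f h = cong₂ _∧_ (h zero) (∀⇒allF (f ∘ suc) (h ∘ suc))

∧-intro : ∀ {a b} → a ≡ true → b ≡ true → a ∧ b ≡ true
∧-intro = cong₂ _∧_

⇔⇒≡ : ∀ {a b : Bool} → (a ≡ true → b ≡ true) → (b ≡ true → a ≡ true) → a ≡ b
⇔⇒≡ {true}          f g = sym (f refl)
⇔⇒≡ {false} {true}  f g = g refl
⇔⇒≡ {false} {false} f g = refl

count-cong : ∀ {n} {f g : Fin n → Bool} → f ≗ g → count f ≡ count g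
count-cong {zero}  h = refl
count-cong {suc n} {f} {g} h rewrite h zero = cong (ℕ._+_ _) (count-cong (h ∘ suc))

-- A bijection of `Fin n` with the subset cut out by `f`; it turns a value of `count` into elements
-- that can be named and indexed.
record Enumeration {m} (f : Fin m → Bool) (n : ℕ) : Set where
  field
    at         : Fin n → Fin m
    sound      : ∀ i → f (at i) ≡ true
    injective  : ∀ i j → at i ≡ at j → i ≡ j
    index      : ∀ q → f q ≡ true → Fin n
    at-index   : ∀ q (h : f q ≡ true) → at (index q h) ≡ q

enumerate-count : ∀ {m} (f : Fin m → Bool) → Enumeration f (count f)
enumerate-count {zero} f = record
  { at = λ () ; sound = λ () ; injective = λ () ; index = λ () ; at-index = λ () }
enumerate-count {suc m} f with f zero in eq | enumerate-count (f ∘ suc)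
... | true | E = record
  { at        = λ { zero → zero ; (suc i) → suc (at i) }
  ; sound     = λ { zero → eq ; (suc i) → sound i }
  ; injective = λ { zero zero _ → refl
                  ; zero (suc j) p → ⊥-elim (0≢1+n p)
                  ; (suc i) zero p → ⊥-elim (0≢1+n (sym p))
                  ; (suc i) (suc j) p → cong suc (injective i j (suc-injective p)) }
  ; index     = λ { zero _ → zero ; (suc q) h → suc (index q h) }
  ; at-index  = λ { zero _ → refl ; (suc q) h → cong suc (at-index q h) }
  } where open Enumeration E
... | false | E = record
  { at        = λ i → suc (at i)
  ; sound     = sound
  ; injective = λ i j p → injective i j (suc-injective p)
  ; index     = λ { zero h → ⊥-elim (false≢true (trans (sym eq) h)) ; (suc q) h → index q h }
  ; at-index  = λ { zero h → ⊥-elim (false≢true (trans (sym eq) h)) ; (suc q) h → cong suc (at-index q h) }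
  } where open Enumeration E

enumerate : ∀ {m n} (f : Fin m → Bool) → count f ≡ n → Enumeration f n
enumerate f refl = enumerate-count f

count≡1⇒unique : ∀ {m} (f : Fin m → Bool) → count f ≡ 1 →
                 ∀ {i j} → f i ≡ true → f j ≡ true → i ≡ j
count≡1⇒unique f c {i} {j} hi hj =
  trans (sym (at-index i hi)) (trans (cong at (Fin1 (index i hi) (index j hj))) (at-index j hj))
  where
  open Enumeration (enumerate f c)
  Fin1 : (a b : Fin 1) → a ≡ b
  Fin1 zero zero = refl

-- The first two enumerated elements differ, so at least one of them is not `i`.
count≥2⇒another : ∀ {m n} (f : Fin m → Bool) → count f ≡ suc (suc n) →
                  ∀ i → ∃ λ j → f j ≡ true × j ≢ i
count≥2⇒another f c i with at zero ≟ i
  where open Enumeration (enumerate f c)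
... | no  ne = at zero , sound zero , ne
  where open Enumeration (enumerate f c)
... | yes e  = at (suc zero) , sound (suc zero) ,
               λ e′ → 0≢1+n (injective _ _ (trans e (sym e′)))
  where open Enumeration (enumerate f c)

-- Finite sums of integers.

module IntegerSums where
  open import Data.Integer using (_+_; _*_; _≤_; +≤+; -[1+_])
  open import Algebra.Properties.Semiring.Sum ℤₚ.+-*-semiring public
    using (sum; sum-syntax; sum-cong-≗; sum-replicate-zero; ∑-distrib-+; ∑-comm;
           *-distribˡ-sum; *-distribʳ-sum)

  ⟦_⟧ : Bool → ℤ
  ⟦ true ⟧  = 1ℤ
  ⟦ false ⟧ = 0ℤ

  ⟦⟧-idem : ∀ b → ⟦ b ⟧ * ⟦ b ⟧ ≡ ⟦ b ⟧
  ⟦⟧-idem true  = refl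
  ⟦⟧-idem false = refl

  ⟦⟧-∧ : ∀ a b → ⟦ a ∧ b ⟧ ≡ ⟦ a ⟧ * ⟦ b ⟧
  ⟦⟧-∧ true  b = sym (ℤₚ.*-identityˡ ⟦ b ⟧)
  ⟦⟧-∧ false b = refl

  count≡sum : ∀ {n} (f : Fin n → Bool) → + count f ≡ ∑[ i < n ] ⟦ f i ⟧
  count≡sum {zero}  f = refl
  count≡sum {suc n} f with f zero
  ... | true  = cong (_+_ 1ℤ) (count≡sum (f ∘ suc))
  ... | false = trans (count≡sum (f ∘ suc)) (sym (ℤₚ.+-identityˡ _))

  sum-zero : ∀ {n} (f : Fin n → ℤ) → (∀ i → f i ≡ 0ℤ) → sum f ≡ 0ℤ
  sum-zero {n} f h = trans (sum-cong-≗ h) (sum-replicate-zero n)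

  sum-single : ∀ {n} (f : Fin n → ℤ) i → (∀ j → j ≢ i → f j ≡ 0ℤ) → sum f ≡ f i
  sum-single f zero h =
    trans (cong (_+_ (f zero)) (sum-zero (f ∘ suc) λ j → h (suc j) (0≢1+n ∘ sym)))
          (ℤₚ.+-identityʳ _)
  sum-single f (suc i) h =
    trans (cong₂ _+_ (h zero 0≢1+n)
                     (sum-single (f ∘ suc) i λ j ne → h (suc j) (ne ∘ suc-injective)))
          (ℤₚ.+-identityˡ _)

  -- Associativity a(Bc) = (aB)c for a row vector, a matrix and a column vector; most double counts
  -- below are instances.
  ∑-assoc : ∀ {m n} (a : Fin m → ℤ) (b : Fin m → Fin n → ℤ) (c : Fin n → ℤ) →
            ∑[ i < m ] (a i * ∑[ j < n ] (b i j * c j)) ≡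
            ∑[ j < n ] (∑[ i < m ] (a i * b i j) * c j)
  ∑-assoc {m} {n} a b c = begin
    ∑[ i < m ] (a i * ∑[ j < n ] (b i j * c j))
      ≡⟨ sum-cong-≗ (λ i → *-distribˡ-sum (a i) (λ j → b i j * c j)) ⟩
    ∑[ i < m ] ∑[ j < n ] (a i * (b i j * c j))
      ≡⟨ ∑-comm (λ i j → a i * (b i j * c j)) ⟩
    ∑[ j < n ] ∑[ i < m ] (a i * (b i j * c j))
      ≡⟨ sum-cong-≗ (λ j → sum-cong-≗ λ i → sym (ℤₚ.*-assoc (a i) (b i j) (c j))) ⟩
    ∑[ j < n ] ∑[ i < m ] (a i * b i j * c j)
      ≡⟨ sum-cong-≗ (λ j → sym (*-distribʳ-sum (c j) (λ i → a i * b i j))) ⟩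
    ∑[ j < n ] (∑[ i < m ] (a i * b i j) * c j) ∎
    where open ≡-Reasoning

  0≤i*i : ∀ i → 0ℤ ≤ i * i
  0≤i*i (+ n)     = subst (0ℤ ≤_) (ℤₚ.pos-* n n) (+≤+ z≤n)
  0≤i*i -[1+ n ]  = +≤+ z≤n

  sum-nonneg : ∀ {n} (f : Fin n → ℤ) → (∀ i → 0ℤ ≤ f i) → 0ℤ ≤ sum f
  sum-nonneg {zero}  f h = ℤₚ.≤-refl
  sum-nonneg {suc n} f h = ℤₚ.+-mono-≤ (h zero) (sum-nonneg (f ∘ suc) (h ∘ suc))

  nonneg-+≡0 : ∀ {i j} → 0ℤ ≤ i → 0ℤ ≤ j → i + j ≡ 0ℤ → i ≡ 0ℤ × j ≡ 0ℤ
  nonneg-+≡0 {+ zero} {+ zero} _ _ _ = refl , refl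

  sum-nonneg≡0 : ∀ {n} (f : Fin n → ℤ) → (∀ i → 0ℤ ≤ f i) → sum f ≡ 0ℤ → ∀ i → f i ≡ 0ℤ
  sum-nonneg≡0 {suc n} f h e i
    with nonneg-+≡0 (h zero) (sum-nonneg (f ∘ suc) (h ∘ suc)) e | i
  ... | z , _ | zero  = z
  ... | _ , z | suc j = sum-nonneg≡0 (f ∘ suc) (h ∘ suc) z j

  -- Definiteness of the inner product: a vector of norm zero vanishes entry by entry.
  sum-squares≡0 : ∀ {n} (f : Fin n → ℤ) → ∑[ i < n ] (f i * f i) ≡ 0ℤ → ∀ i → f i ≡ 0ℤ
  sum-squares≡0 f e i = [ (λ z → z) , (λ z → z) ]′
    (ℤₚ.i*j≡0⇒i≡0∨j≡0 (f i) (sum-nonneg≡0 (λ i → f i * f i) (λ i → 0≤i*i (f i)) e i))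

-- Elementary incidence geometry of a generalized quadrangle.

module Quadrangle {nP nL : ℕ} (I : Fin nP → Fin nL → Bool) {s t : ℕ} (gq : IsGQ I s t) where
  open IsGQ gq

  infix 4 _∈_ _∉_ _~_
  _∈_ _∉_ : Fin nP → Fin nL → Set
  p ∈ L = I p L ≡ true
  p ∉ L = I p L ≡ false

  _~_ : Fin nP → Fin nP → Set
  p ~ q = col I p q ≡ true

  Disjoint : Fin nL → Fin nL → Set
  Disjoint L M = ∀ p → p ∈ L → p ∈ M → ⊥

  ~-intro : ∀ {p q} L → p ∈ L → q ∈ L → p ~ q
  ~-intro L pL qL = ∃⇒anyF _ L (∧-intro pL qL)

  ~-elim : ∀ {p q} → p ~ q → ∃ λ L → p ∈ L × q ∈ L
  ~-elim h = let L , e = anyF⇒∃ _ h in L , ∧-conicalˡ _ _ e , ∧-conicalʳ _ _ e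

  ~-sym : ∀ {p q} → p ~ q → q ~ p
  ~-sym h = let L , pL , qL = ~-elim h in ~-intro L qL pL

  disjoint⇒≢ : ∀ {L M} → Disjoint L M → L ≢ M
  disjoint⇒≢ {L} dis refl =
    dis _ (Enumeration.sound E zero) (Enumeration.sound E zero)
    where E = enumerate (λ p → I p L) (linePts L)

  ∉-intro : ∀ {p L} → (p ∈ L → ⊥) → p ∉ L
  ∉-intro = ¬-not

  project : ∀ {p L} → p ∉ L → ∃ λ q → q ∈ L × p ~ q
  project {p} {L} f = at zero , ∧-conicalˡ _ _ (sound zero) , ∧-conicalʳ (I _ L) _ (sound zero)
    where open Enumeration (enumerate (λ q → I q L ∧ col I p q) (gqAxiom p L f))

  -- The uniqueness half of the quadrangle axiom; `project` is the existence half.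
  no-triangle : ∀ {p q r L} → p ∉ L → q ∈ L → r ∈ L → p ~ q → p ~ r → q ≡ r
  no-triangle {p} {L = L} f qL rL pq pr =
    count≡1⇒unique _ (gqAxiom p L f) (∧-intro qL pq) (∧-intro rL pr)

  same-line : ∀ {p q L M} → p ≢ q → p ∈ L → q ∈ L → p ∈ M → q ∈ M → L ≡ M
  same-line ne pL qL pM qM = partial _ _ _ _ ne pL qL pM qM

  same-point : ∀ {p q L M} → L ≢ M → p ∈ L → p ∈ M → q ∈ L → q ∈ M → p ≡ q
  same-point {p} {q} ne pL pM qL qM with p ≟ q
  ... | yes e = e
  ... | no p≢q = ⊥-elim (ne (same-line p≢q pL qL pM qM))

  -- A common point off `N` would form a triangle with `p` and `q`; a common point on `N` would
  -- equal both of them.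
  disjoint-on-line : ∀ {p q L M N} → p ≢ q → p ∈ N → q ∈ N → p ∈ L → q ∈ M →
                     L ≢ N → M ≢ N → Disjoint L M
  disjoint-on-line {N = N} p≢q pN qN pL qM L≢N M≢N r rL rM with I r N in e
  ... | true  = p≢q (trans (same-point L≢N pL pN rL e) (same-point M≢N rM e qM qN))
  ... | false = p≢q (no-triangle e pN qN (~-intro _ rL pL) (~-intro _ rM qM))

  line-through : ∀ p → ∃ λ L → p ∈ L
  line-through p = at zero , sound zero
    where open Enumeration (enumerate (I p) (ptLines p))

  another-line : ∀ {n} → t ≡ suc n → ∀ p L → ∃ λ M → p ∈ M × M ≢ L
  another-line refl p L = count≥2⇒another (I p) (ptLines p) L

  another-point : ∀ {n} → s ≡ suc n → ∀ L p → ∃ λ q → q ∈ L × q ≢ p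
  another-point refl L p = count≥2⇒another (λ q → I q L) (linePts L) p

  -- The incidence matrix and its matrix identities.

  open import Data.Integer using (_+_; _*_; -_)
  open import Data.Integer.Tactic.RingSolver using (solve-∀)
  open IntegerSums
  open ≡-Reasoning

  incid : Fin nP → Fin nL → ℤ
  incid p L = ⟦ I p L ⟧

  -- `join` and `meet` are the entries of NNᵀ and NᵀN, where N is the incidence matrix.
  join : Fin nP → Fin nP → ℤ
  join p q = ∑[ L < nL ] (incid p L * incid q L)

  meet : Fin nL → Fin nL → ℤ
  meet L M = ∑[ p < nP ] (incid p L * incid p M)

  incid-∈ : ∀ {p L} → p ∈ L → incid p L ≡ 1ℤ
  incid-∈ = cong ⟦_⟧

  incid*incid≡0 : ∀ {p q L M} → (p ∈ L → q ∈ M → ⊥) → incid p L * incid q M ≡ 0ℤ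
  incid*incid≡0 {p} {q} {L} {M} h with I p L | I q M
  ... | true  | true  = ⊥-elim (h refl refl)
  ... | true  | false = refl
  ... | false | true  = refl
  ... | false | false = refl

  ∑-incid-line : ∀ L → ∑[ p < nP ] incid p L ≡ + suc s
  ∑-incid-line L = trans (sym (count≡sum (λ p → I p L))) (cong +_ (linePts L))

  ∑-incid-point : ∀ p → ∑[ L < nL ] incid p L ≡ + suc t
  ∑-incid-point p = trans (sym (count≡sum (I p))) (cong +_ (ptLines p))

  join-self : ∀ p → join p p ≡ + suc t
  join-self p = trans (sum-cong-≗ λ L → ⟦⟧-idem (I p L)) (∑-incid-point p)

  join-≢ : ∀ {p q} → p ≢ q → join p q ≡ ⟦ col I p q ⟧
  join-≢ {p} {q} ne with col I p q in e
  ... | true  = let L , pL , qL = ~-elim e in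
    trans (sum-single _ L λ M M≢L → incid*incid≡0 λ pM qM → M≢L (same-line ne pM qM pL qL))
          (cong₂ _*_ (incid-∈ pL) (incid-∈ qL))
  ... | false = sum-zero _ λ L → incid*incid≡0 λ pL qL → false≢true (trans (sym e) (~-intro L pL qL))

  meet-comm : ∀ L M → meet L M ≡ meet M L
  meet-comm L M = sum-cong-≗ λ p → ℤₚ.*-comm (incid p L) (incid p M)

  meet-self : ∀ L → meet L L ≡ + suc s
  meet-self L = trans (sum-cong-≗ λ p → ⟦⟧-idem (I p L)) (∑-incid-line L)

  meet-concurrent : ∀ {p L M} → L ≢ M → p ∈ L → p ∈ M → meet L M ≡ 1ℤ
  meet-concurrent {p} ne pL pM =
    trans (sum-single _ p λ q q≢p → incid*incid≡0 λ qL qM → q≢p (same-point ne qL qM pL pM))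
          (cong₂ _*_ (incid-∈ pL) (incid-∈ pM))

  meet-disjoint : ∀ {L M} → Disjoint L M → meet L M ≡ 0ℤ
  meet-disjoint dis = sum-zero _ λ p → incid*incid≡0 (dis p)

  meets? : ∀ L M → (∃ λ p → p ∈ L × p ∈ M) ⊎ Disjoint L M
  meets? L M with anyF (λ p → I p L ∧ I p M) in e
  ... | true  = let p , h = anyF⇒∃ _ e in inj₁ (p , ∧-conicalˡ _ _ h , ∧-conicalʳ _ _ h)
  ... | false = inj₂ λ p pL pM → false≢true (trans (sym e) (∃⇒anyF _ p (∧-intro pL pM)))

  -- The matrix form N(NᵀN) = (s+t)N + J of the quadrangle axiom, N being the incidence matrix.
  ∑-incid-meet : ∀ p M → ∑[ L < nL ] (incid p L * meet L M) ≡ (+ s + + t) * incid p M + 1ℤ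
  ∑-incid-meet p M = trans (∑-assoc (incid p) (λ L q → incid q L) (λ q → incid q M)) joins
    where
    joins : ∑[ q < nP ] (join p q * incid q M) ≡ (+ s + + t) * incid p M + 1ℤ
    joins with I p M in e
    ... | false = begin
      ∑[ q < nP ] (join p q * incid q M)         ≡⟨ sum-cong-≗ off ⟩
      ∑[ q < nP ] ⟦ I q M ∧ col I p q ⟧         ≡⟨ sym (count≡sum (λ q → I q M ∧ col I p q)) ⟩
      + count (λ q → I q M ∧ col I p q)        ≡⟨ cong +_ (gqAxiom p M e) ⟩
      1ℤ                                       ≡⟨ cong (_+ 1ℤ) (sym (ℤₚ.*-zeroʳ (+ s + + t))) ⟩
      (+ s + + t) * 0ℤ + 1ℤ                    ∎
      where
      off : ∀ q → join p q * incid q M ≡ ⟦ I q M ∧ col I p q ⟧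
      off q with I q M in f
      ... | false = ℤₚ.*-zeroʳ (join p q)
      ... | true  = trans (ℤₚ.*-identityʳ _)
                          (join-≢ λ { refl → false≢true (trans (sym e) f) })
    -- For `p` on `M`, `join p q` is 1 at every other point `q` of `M` and t + 1 at `p`. Splitting
    -- off 1 leaves an excess supported at `p`, so the total is (s + 1) + t.
    ... | true = begin
      ∑[ q < nP ] (join p q * incid q M)
        ≡⟨ sum-cong-≗ (λ q → shift (join p q) (incid q M)) ⟩
      ∑[ q < nP ] (incid q M + (join p q + - 1ℤ) * incid q M)
        ≡⟨ ∑-distrib-+ (λ q → incid q M) (λ q → (join p q + - 1ℤ) * incid q M) ⟩
      ∑[ q < nP ] incid q M + ∑[ q < nP ] ((join p q + - 1ℤ) * incid q M)
        ≡⟨ cong₂ _+_ (∑-incid-line M) (sum-single _ p on) ⟩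
      + suc s + (join p p + - 1ℤ) * incid p M
        ≡⟨ cong₂ (λ j i → + suc s + (j + - 1ℤ) * i) (join-self p) (incid-∈ e) ⟩
      + suc s + (+ suc t + - 1ℤ) * 1ℤ
        ≡⟨ total (+ s) (+ t) ⟩
      (+ s + + t) * 1ℤ + 1ℤ ∎
      where
      shift : ∀ j i → j * i ≡ i + (j + - 1ℤ) * i
      shift = solve-∀
      total : ∀ s t → (1ℤ + s) + ((1ℤ + t) + - 1ℤ) * 1ℤ ≡ (s + t) * 1ℤ + 1ℤ
      total = solve-∀
      on : ∀ q → q ≢ p → (join p q + - 1ℤ) * incid q M ≡ 0ℤ
      on q q≢p with I q M in f
      ... | false = ℤₚ.*-zeroʳ (join p q + - 1ℤ)
      ... | true rewrite join-≢ (q≢p ∘ sym) | ~-intro M e f = refl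

  -- N u = 0, so u is orthogonal both to NᵀN v and to the constants; hence ⟨u,u⟩ = −(s+t)⟨u,v⟩ = 0.
  residual≡0 : ∀ (v : Fin nL → ℤ) κ →
    let u = λ L → ∑[ M < nL ] (meet L M * v M) + (- (+ s + + t) * v L + - κ) in
    ∑[ L < nL ] v L ≡ κ * + suc t → (∀ L → u L * v L ≡ 0ℤ) → ∀ L → u L ≡ 0ℤ
  residual≡0 v κ ∑v u⊥v = sum-squares≡0 u u·u
    where
    k : ℤ
    k = + s + + t

    Mv u : Fin nL → ℤ
    Mv L = ∑[ M < nL ] (meet L M * v M)
    u L = Mv L + (- k * v L + - κ)

    ∑-u : ∀ (a : Fin nL → ℤ) → ∑[ L < nL ] (a L * u L) ≡
          ∑[ L < nL ] (a L * Mv L) + (- k * ∑[ L < nL ] (a L * v L) + - κ * ∑[ L < nL ] a L)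
    ∑-u a = begin
      ∑[ L < nL ] (a L * u L)
        ≡⟨ sum-cong-≗ (λ L → expand (a L) (Mv L) (- k) (v L) (- κ)) ⟩
      ∑[ L < nL ] (a L * Mv L + (- k * (a L * v L) + - κ * a L))
        ≡⟨ ∑-distrib-+ (λ L → a L * Mv L) (λ L → - k * (a L * v L) + - κ * a L) ⟩
      ∑[ L < nL ] (a L * Mv L) + ∑[ L < nL ] (- k * (a L * v L) + - κ * a L)
        ≡⟨ cong (_+_ aMv) (∑-distrib-+ (λ L → - k * (a L * v L)) (λ L → - κ * a L)) ⟩
      ∑[ L < nL ] (a L * Mv L) + (∑[ L < nL ] (- k * (a L * v L)) + ∑[ L < nL ] (- κ * a L))
        ≡⟨ cong (_+_ aMv) (sym (cong₂ _+_ (*-distribˡ-sum (- k) (λ L → a L * v L))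
                                        (*-distribˡ-sum (- κ) a))) ⟩
      ∑[ L < nL ] (a L * Mv L) + (- k * ∑[ L < nL ] (a L * v L) + - κ * ∑[ L < nL ] a L) ∎
      where
      aMv = ∑[ L < nL ] (a L * Mv L)
      expand : ∀ a m k v κ → a * (m + (k * v + κ)) ≡ a * m + (k * (a * v) + κ * a)
      expand = solve-∀

    -- N(NᵀN)v = (s+t)Nv + Jv, and by the hypothesis on the sum of `v` the last term is κ(t+1),
    -- which N applied to the constant κ cancels.
    Nu : ∀ p → ∑[ L < nL ] (incid p L * u L) ≡ 0ℤ
    Nu p = begin
      ∑[ L < nL ] (incid p L * u L)
        ≡⟨ ∑-u (incid p) ⟩
      ∑[ L < nL ] (incid p L * Mv L) + (- k * pv + - κ * ∑[ L < nL ] incid p L)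
        ≡⟨ cong₂ (λ a b → a + (- k * pv + - κ * b)) NMv (∑-incid-point p) ⟩
      (k * pv + κ * + suc t) + (- k * pv + - κ * + suc t)
        ≡⟨ cancel k pv κ (+ suc t) ⟩
      0ℤ ∎
      where
      pv = ∑[ L < nL ] (incid p L * v L)
      cancel : ∀ k x κ y → (k * x + κ * y) + (- k * x + - κ * y) ≡ 0ℤ
      cancel = solve-∀
      factor : ∀ k i v → (k * i + 1ℤ) * v ≡ k * (i * v) + v
      factor = solve-∀
      NMv : ∑[ L < nL ] (incid p L * Mv L) ≡ k * pv + κ * + suc t
      NMv = begin
        ∑[ L < nL ] (incid p L * Mv L)
          ≡⟨ ∑-assoc (incid p) meet v ⟩
        ∑[ M < nL ] (∑[ L < nL ] (incid p L * meet L M) * v M)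
          ≡⟨ sum-cong-≗ (λ M → trans (cong (_* v M) (∑-incid-meet p M)) (factor k (incid p M) (v M))) ⟩
        ∑[ M < nL ] (k * (incid p M * v M) + v M)
          ≡⟨ ∑-distrib-+ (λ M → k * (incid p M * v M)) v ⟩
        ∑[ M < nL ] (k * (incid p M * v M)) + ∑[ M < nL ] v M
          ≡⟨ cong₂ _+_ (sym (*-distribˡ-sum k (λ M → incid p M * v M))) ∑v ⟩
        k * pv + κ * + suc t ∎

    -- Summing `Nu` over all points counts each line s + 1 times, and this nonzero factor cancels.
    ∑u : ∑[ L < nL ] u L ≡ 0ℤ
    ∑u with ℤₚ.i*j≡0⇒i≡0∨j≡0 (+ suc s) (begin
        + suc s * ∑[ L < nL ] u L
          ≡⟨ *-distribˡ-sum (+ suc s) u ⟩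
        ∑[ L < nL ] (+ suc s * u L)
          ≡⟨ sum-cong-≗ (λ L → trans (cong (_* u L) (sym (∑-incid-line L)))
                                     (*-distribʳ-sum (u L) (λ p → incid p L))) ⟩
        ∑[ L < nL ] ∑[ p < nP ] (incid p L * u L)
          ≡⟨ ∑-comm (λ L p → incid p L * u L) ⟩
        ∑[ p < nP ] ∑[ L < nL ] (incid p L * u L)
          ≡⟨ sum-zero _ Nu ⟩
        0ℤ ∎)
    ... | inj₂ z = z

    u·Mv : ∑[ L < nL ] (u L * Mv L) ≡ 0ℤ
    u·Mv = trans (∑-assoc u meet v) (sum-zero _ λ M → cong (_* v M) (uM M))
      where
      uM : ∀ M → ∑[ L < nL ] (u L * meet L M) ≡ 0ℤ
      uM M = trans (∑-assoc u (λ L p → incid p L) (λ p → incid p M))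
        (sum-zero _ λ p → cong (_* incid p M)
          (trans (sum-cong-≗ λ L → ℤₚ.*-comm (u L) (incid p L)) (Nu p)))

    u·u : ∑[ L < nL ] (u L * u L) ≡ 0ℤ
    u·u = begin
      ∑[ L < nL ] (u L * u L)
        ≡⟨ ∑-u u ⟩
      ∑[ L < nL ] (u L * Mv L) + (- k * ∑[ L < nL ] (u L * v L) + - κ * ∑[ L < nL ] u L)
        ≡⟨ cong₂ _+_ u·Mv (cong₂ (λ a b → - k * a + - κ * b) (sum-zero _ u⊥v) ∑u) ⟩
      0ℤ + (- k * 0ℤ + - κ * 0ℤ)
        ≡⟨ zeros k κ ⟩
      0ℤ ∎
      where
      zeros : ∀ k κ → 0ℤ + (- k * 0ℤ + - κ * 0ℤ) ≡ 0ℤ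
      zeros = solve-∀

  -- (NᵀN)² = (s+t)NᵀN + (s+1)J: the identity `∑-incid-meet` multiplied on the left by Nᵀ.
  ∑-meet-meet : ∀ L M → ∑[ S < nL ] (meet L S * meet S M) ≡ (+ s + + t) * meet L M + + suc s
  ∑-meet-meet L M = begin
    ∑[ S < nL ] (meet L S * meet S M)
      ≡⟨ sym (∑-assoc (λ p → incid p L) incid (λ S → meet S M)) ⟩
    ∑[ p < nP ] (incid p L * ∑[ S < nL ] (incid p S * meet S M))
      ≡⟨ sum-cong-≗ (λ p → trans (cong (incid p L *_) (∑-incid-meet p M))
                                 (expand (incid p L) k (incid p M))) ⟩
    ∑[ p < nP ] (k * (incid p L * incid p M) + incid p L)
      ≡⟨ ∑-distrib-+ (λ p → k * (incid p L * incid p M)) (λ p → incid p L) ⟩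
    ∑[ p < nP ] (k * (incid p L * incid p M)) + ∑[ p < nP ] incid p L
      ≡⟨ cong₂ _+_ (sym (*-distribˡ-sum k (λ p → incid p L * incid p M))) (∑-incid-line L) ⟩
    k * meet L M + + suc s ∎
    where
    k : ℤ
    k = + s + + t
    expand : ∀ i k j → i * (k * j + 1ℤ) ≡ k * (i * j) + i
    expand = solve-∀

  -- Transversals of two disjoint lines and centers of triads of lines.

  δ : Fin nL → Fin nL → ℤ
  δ L M = ⟦ ⌊ L ≟ M ⌋ ⟧

  δ-self : ∀ L → δ L L ≡ 1ℤ
  δ-self L with L ≟ L
  ... | yes _ = refl
  ... | no ne = ⊥-elim (ne refl)

  δ-≢ : ∀ {L M} → L ≢ M → δ L M ≡ 0ℤ
  δ-≢ {L} {M} ne with L ≟ M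
  ... | yes e = ⊥-elim (ne e)
  ... | no _  = refl

  ∑-δ : ∀ (f : Fin nL → ℤ) M → ∑[ L < nL ] (f L * δ L M) ≡ f M
  ∑-δ f M = trans (sum-single _ M λ L ne → trans (cong (f L *_) (δ-≢ ne)) (ℤₚ.*-zeroʳ (f L)))
                  (trans (cong (f M *_) (δ-self M)) (ℤₚ.*-identityʳ (f M)))

  -- Distinct lines share at most one point, so the factor is 0 or 1 and hence idempotent.
  meet-absorb : ∀ {L S} x → L ≢ S → meet L S * (meet L S * x) ≡ meet L S * x
  meet-absorb {L} {S} x ne with meets? L S
  ... | inj₁ (p , pL , pS) rewrite meet-concurrent ne pL pS = ℤₚ.*-identityˡ (1ℤ * x)
  ... | inj₂ dis rewrite meet-disjoint dis = refl

  module _ {A B : Fin nL} (A∥B : Disjoint A B) where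

    -- The 0/1 indicator of the lines meeting both `A` and `B`. It is 0 at `A` and at `B`
    -- themselves, because these lines are disjoint.
    transversal : Fin nL → ℤ
    transversal S = meet A S * meet B S

    transversalˡ : transversal A ≡ 0ℤ
    transversalˡ = trans (cong (meet A A *_) (meet-disjoint λ p pB pA → A∥B p pA pB))
                         (ℤₚ.*-zeroʳ (meet A A))

    transversalʳ : transversal B ≡ 0ℤ
    transversalʳ = cong (_* meet B B) (meet-disjoint A∥B)

    -- The entry of (NᵀN)² at two disjoint lines; geometrically, one transversal for each point of
    -- `A`.
    ∑-transversal : ∑[ S < nL ] transversal S ≡ + suc s
    ∑-transversal = begin
      ∑[ S < nL ] transversal S
        ≡⟨ sum-cong-≗ (λ S → cong (meet A S *_) (meet-comm B S)) ⟩
      ∑[ S < nL ] (meet A S * meet S B)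
        ≡⟨ ∑-meet-meet A B ⟩
      (+ s + + t) * meet A B + + suc s
        ≡⟨ cong (λ m → (+ s + + t) * m + + suc s) (meet-disjoint A∥B) ⟩
      (+ s + + t) * 0ℤ + + suc s
        ≡⟨ cong (_+ + suc s) (ℤₚ.*-zeroʳ (+ s + + t)) ⟩
      0ℤ + + suc s ∎

    -- For `C` disjoint from `A` and `B` this is the number of centers of the triad. At a
    -- transversal `C` the diagonal term has weight s + 1.
    centers : Fin nL → ℤ
    centers C = ∑[ S < nL ] (meet C S * transversal S)

    -- Every transversal meets `A`, so the extra factor is absorbed.
    centersˡ : centers A ≡ + suc s
    centersˡ = trans (sum-cong-≗ absorb) ∑-transversal
      where
      absorb : ∀ S → meet A S * transversal S ≡ transversal S
      absorb S with A ≟ S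
      ... | yes refl = trans (cong (meet A A *_) transversalˡ)
                             (trans (ℤₚ.*-zeroʳ (meet A A)) (sym transversalˡ))
      ... | no ne    = meet-absorb (meet B S) ne

    centersʳ : centers B ≡ + suc s
    centersʳ = trans (sum-cong-≗ absorb) ∑-transversal
      where
      absorb : ∀ S → meet B S * transversal S ≡ transversal S
      absorb S with B ≟ S
      ... | yes refl = trans (cong (meet B B *_) transversalʳ)
                             (trans (ℤₚ.*-zeroʳ (meet B B)) (sym transversalʳ))
      ... | no ne    = begin
        meet B S * (meet A S * meet B S) ≡⟨ cong (meet B S *_) (ℤₚ.*-comm (meet A S) (meet B S)) ⟩
        meet B S * (meet B S * meet A S) ≡⟨ meet-absorb (meet A S) ne ⟩
        meet B S * meet A S              ≡⟨ ℤₚ.*-comm (meet B S) (meet A S) ⟩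
        meet A S * meet B S              ∎

    -- If `a` and `a′` differ, a common point would close a triangle on `A`. If they agree,
    -- projecting to `B` gives `b` = `b′`, and then `S` = `T`.
    transversals-disjoint :
      ∀ {S T a a′ b b′} → S ≢ A → S ≢ T → T ≢ A →
      a ∈ A → a ∈ S → b ∈ B → b ∈ S → a′ ∈ A → a′ ∈ T → b′ ∈ B → b′ ∈ T → Disjoint S T
    transversals-disjoint {a = a} {a′} S≢A S≢T T≢A aA aS bB bS a′A a′T b′B b′T with a ≟ a′
    ... | no a≢a′  = disjoint-on-line a≢a′ aA a′A aS a′T S≢A T≢A
    ... | yes refl with no-triangle (∉-intro (A∥B a aA)) bB b′B (~-intro _ aS bS) (~-intro _ a′T b′T)
    ...   | refl = ⊥-elim (S≢T (same-line (λ { refl → A∥B a aA bB }) aS bS a′T b′T))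

    -- Distinct transversals are disjoint, so only the diagonal term survives.
    centers-transversal : ∀ {S a b} → S ≢ A → S ≢ B → a ∈ A → a ∈ S → b ∈ B → b ∈ S →
                          transversal S ≡ 1ℤ × centers S ≡ + suc s
    centers-transversal {S} {a} {b} S≢A S≢B aA aS bB bS = one ,
      trans (sum-single _ S others)
            (trans (cong₂ _*_ (meet-self S) one) (ℤₚ.*-identityʳ (+ suc s)))
      where
      one : transversal S ≡ 1ℤ
      one = cong₂ _*_ (meet-concurrent (S≢A ∘ sym) aA aS) (meet-concurrent (S≢B ∘ sym) bB bS)
      others : ∀ T → T ≢ S → meet S T * transversal T ≡ 0ℤ
      others T T≢S with T ≟ A | meets? A T | meets? B T
      ... | yes refl | _ | _ = trans (cong (meet S A *_) transversalˡ) (ℤₚ.*-zeroʳ (meet S A))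
      ... | no _ | inj₂ dis | _ rewrite meet-disjoint dis = ℤₚ.*-zeroʳ (meet S T)
      ... | no _ | _ | inj₂ dis rewrite meet-disjoint dis =
        trans (cong (meet S T *_) (ℤₚ.*-zeroʳ (meet A T))) (ℤₚ.*-zeroʳ (meet S T))
      ... | no T≢A | inj₁ (a′ , a′A , a′T) | inj₁ (b′ , b′B , b′T) =
        cong (_* transversal T) (meet-disjoint
          (transversals-disjoint S≢A (T≢S ∘ sym) T≢A aA aS bB bS a′A a′T b′B b′T))

    -- The vector v = transversal + t (δ_A + δ_B) realises equality in the dual of Higman's inequality s ≤ t².
    triad-centers : s ≡ t ℕ.* t → ∀ {C} → Disjoint A C → Disjoint B C → centers C ≡ + suc t
    triad-centers s≡t² {C} A∥C B∥C = begin
      centers C                  ≡⟨ split (centers C) T ⟩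
      -- At `C` all data of `v` vanish, so `u C` is `centers C` minus t + 1; `residual≡0` makes it
      -- zero.
      F (centers C) 0ℤ 0ℤ 0ℤ 0ℤ 0ℤ + + suc t
        ≡⟨ cong (_+ + suc t) (trans (sym (u≡F C refl (meet-disjoint (swap A∥C)) (meet-disjoint (swap B∥C))
             (cong (_* meet B C) (meet-disjoint A∥C))
             (δ-≢ (disjoint⇒≢ (swap A∥C))) (δ-≢ (disjoint⇒≢ (swap B∥C)))))
             (residual≡0 v (+ suc t) ∑v u⊥v C)) ⟩
      0ℤ + + suc t               ∎
      where
      swap : ∀ {L M} → Disjoint L M → Disjoint M L
      swap dis p pM pL = dis p pL pM

      A≢B : A ≢ B
      A≢B = disjoint⇒≢ A∥B

      T : ℤ
      T = + t

      S≡T² : + s ≡ T * T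
      S≡T² = trans (cong +_ s≡t²) (ℤₚ.pos-* t t)

      v u : Fin nL → ℤ
      v L = transversal L + T * (δ L A + δ L B)
      u L = ∑[ M < nL ] (meet L M * v M) + (- (+ s + T) * v L + - + suc t)

      -- The value of `u` at a line in terms of `centers`, the meets with `A` and `B`, `transversal`
      -- and the two deltas there, with s replaced by t². Each case then becomes a polynomial
      -- identity in t.
      F : (c m m′ w d d′ : ℤ) → ℤ
      F c m m′ w d d′ = (c + T * (m + m′)) + (- (T * T + T) * (w + T * (d + d′)) + - (1ℤ + T))

      ∑-split : ∀ (f : Fin nL → ℤ) → ∑[ M < nL ] (f M * v M) ≡
                ∑[ M < nL ] (f M * transversal M) + T * (f A + f B)
      ∑-split f = begin
        ∑[ M < nL ] (f M * v M)
          ≡⟨ sum-cong-≗ (λ M → expand (f M) (transversal M) T (δ M A) (δ M B)) ⟩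
        ∑[ M < nL ] (f M * transversal M + T * (f M * δ M A + f M * δ M B))
          ≡⟨ ∑-distrib-+ (λ M → f M * transversal M) (λ M → T * (f M * δ M A + f M * δ M B)) ⟩
        fw + ∑[ M < nL ] (T * (f M * δ M A + f M * δ M B))
          ≡⟨ cong (_+_ fw) (sym (*-distribˡ-sum T (λ M → f M * δ M A + f M * δ M B))) ⟩
        fw + T * ∑[ M < nL ] (f M * δ M A + f M * δ M B)
          ≡⟨ cong (λ x → fw + T * x) (∑-distrib-+ (λ M → f M * δ M A) (λ M → f M * δ M B)) ⟩
        fw + T * (∑[ M < nL ] (f M * δ M A) + ∑[ M < nL ] (f M * δ M B))
          ≡⟨ cong (λ x → fw + T * x) (cong₂ _+_ (∑-δ f A) (∑-δ f B)) ⟩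
        fw + T * (f A + f B) ∎
        where
        fw = ∑[ M < nL ] (f M * transversal M)
        expand : ∀ m w T d d′ → m * (w + T * (d + d′)) ≡ m * w + T * (m * d + m * d′)
        expand = solve-∀

      u≡F : ∀ L {c m m′ w d d′} → centers L ≡ c → meet L A ≡ m → meet L B ≡ m′ →
            transversal L ≡ w → δ L A ≡ d → δ L B ≡ d′ → u L ≡ F c m m′ w d d′
      u≡F L refl refl refl refl refl refl =
        cong₂ (λ x S → x + (- (S + T) * v L + - + suc t)) (∑-split (meet L)) S≡T²

      -- The hypothesis of `residual≡0` for κ = t + 1: (1 + t²) + 2t = (t + 1)².
      ∑v : ∑[ L < nL ] v L ≡ + suc t * + suc t
      ∑v = begin
        ∑[ L < nL ] v L
          ≡⟨ sum-cong-≗ (λ L → sym (ℤₚ.*-identityˡ (v L))) ⟩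
        ∑[ L < nL ] (1ℤ * v L)
          ≡⟨ ∑-split (λ _ → 1ℤ) ⟩
        ∑[ L < nL ] (1ℤ * transversal L) + T * (1ℤ + 1ℤ)
          ≡⟨ cong (_+ T * (1ℤ + 1ℤ)) (sum-cong-≗ λ L → ℤₚ.*-identityˡ (transversal L)) ⟩
        ∑[ L < nL ] transversal L + T * (1ℤ + 1ℤ)
          ≡⟨ cong (_+ T * (1ℤ + 1ℤ)) (trans ∑-transversal (cong (_+_ 1ℤ) S≡T²)) ⟩
        (1ℤ + T * T) + T * (1ℤ + 1ℤ)
          ≡⟨ square T ⟩
        (1ℤ + T) * (1ℤ + T) ∎
        where
        square : ∀ T → (1ℤ + T * T) + T * (1ℤ + 1ℤ) ≡ (1ℤ + T) * (1ℤ + T)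
        square = solve-∀

      split : ∀ c T → c ≡ ((c + T * (0ℤ + 0ℤ)) + (- (T * T + T) * (0ℤ + T * (0ℤ + 0ℤ)) + - (1ℤ + T)))
                          + (1ℤ + T)
      split = solve-∀

      1+s≡ : + suc s ≡ 1ℤ + T * T
      1+s≡ = cong (_+_ 1ℤ) S≡T²

      uA : u A ≡ 0ℤ
      uA = trans (u≡F A (trans centersˡ 1+s≡) (trans (meet-self A) 1+s≡) (meet-disjoint A∥B)
                        transversalˡ (δ-self A) (δ-≢ A≢B))
                 (ring T)
        where
        ring : ∀ T → ((1ℤ + T * T) + T * ((1ℤ + T * T) + 0ℤ)) +
                     (- (T * T + T) * (0ℤ + T * (1ℤ + 0ℤ)) + - (1ℤ + T)) ≡ 0ℤ
        ring = solve-∀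

      uB : u B ≡ 0ℤ
      uB = trans (u≡F B (trans centersʳ 1+s≡) (meet-disjoint (swap A∥B)) (trans (meet-self B) 1+s≡)
                        transversalʳ (δ-≢ (A≢B ∘ sym)) (δ-self B))
                 (ring T)
        where
        ring : ∀ T → ((1ℤ + T * T) + T * (0ℤ + (1ℤ + T * T))) +
                     (- (T * T + T) * (0ℤ + T * (0ℤ + 1ℤ)) + - (1ℤ + T)) ≡ 0ℤ
        ring = solve-∀

      u-transversal : ∀ {S a b} → S ≢ A → S ≢ B → a ∈ A → a ∈ S → b ∈ B → b ∈ S → u S ≡ 0ℤ
      u-transversal {S} S≢A S≢B aA aS bB bS =
        let w≡1 , c≡ = centers-transversal S≢A S≢B aA aS bB bS in
        trans (u≡F S (trans c≡ 1+s≡) (meet-concurrent S≢A aS aA) (meet-concurrent S≢B bS bB)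
                     w≡1 (δ-≢ S≢A) (δ-≢ S≢B))
              (ring T)
        where
        ring : ∀ T → ((1ℤ + T * T) + T * (1ℤ + 1ℤ)) +
                     (- (T * T + T) * (1ℤ + T * (0ℤ + 0ℤ)) + - (1ℤ + T)) ≡ 0ℤ
        ring = solve-∀

      v≡0 : ∀ {L} → L ≢ A → L ≢ B → transversal L ≡ 0ℤ → v L ≡ 0ℤ
      v≡0 L≢A L≢B w≡0 =
        trans (cong₂ (λ w d → w + T * d) w≡0 (cong₂ _+_ (δ-≢ L≢A) (δ-≢ L≢B)))
              (trans (ℤₚ.+-identityˡ (T * 0ℤ)) (ℤₚ.*-zeroʳ T))

      -- The support of `v` lies in `A`, `B` and their transversals, and `u` vanishes on all of
      -- these.
      v-or-u≡0 : ∀ L → Dec (L ≡ A) → Dec (L ≡ B) → (∃ λ a → a ∈ A × a ∈ L) ⊎ Disjoint A L →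
                 (∃ λ b → b ∈ B × b ∈ L) ⊎ Disjoint B L → u L ≡ 0ℤ ⊎ v L ≡ 0ℤ
      v-or-u≡0 L (yes refl) _ _ _ = inj₁ uA
      v-or-u≡0 L (no _) (yes refl) _ _ = inj₁ uB
      v-or-u≡0 L (no L≢A) (no L≢B) (inj₁ (a , aA , aL)) (inj₁ (b , bB , bL)) =
        inj₁ (u-transversal L≢A L≢B aA aL bB bL)
      v-or-u≡0 L (no L≢A) (no L≢B) (inj₂ dis) _ =
        inj₂ (v≡0 L≢A L≢B (cong (_* meet B L) (meet-disjoint dis)))
      v-or-u≡0 L (no L≢A) (no L≢B) (inj₁ _) (inj₂ dis) =
        inj₂ (v≡0 L≢A L≢B (trans (cong (meet A L *_) (meet-disjoint dis)) (ℤₚ.*-zeroʳ (meet A L))))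

      u⊥v : ∀ L → u L * v L ≡ 0ℤ
      u⊥v L = [ cong (_* v L) , (λ z → trans (cong (u L *_) z) (ℤₚ.*-zeroʳ (u L))) ]′
        (v-or-u≡0 L (L ≟ A) (L ≟ B) (meets? A L) (meets? B L))

  -- By triad-centers the number of centers is t + 1 > 1.
  unique-center⇒⊥ : s ≡ t ℕ.* t → t ≢ 0 → ∀ {A B C} N → Disjoint A B → Disjoint A C → Disjoint B C →
    (∃ λ p → p ∈ A × p ∈ N) → (∃ λ p → p ∈ B × p ∈ N) → (∃ λ p → p ∈ C × p ∈ N) →
    (∀ {S a b c} → a ∈ A → a ∈ S → b ∈ B → b ∈ S → c ∈ C → c ∈ S → S ≡ N) → ⊥
  unique-center⇒⊥ s≡t² t≢0 {A} {B} {C} N A∥B A∥C B∥C (a , aA , aN) (b , bB , bN) (c , cC , cN) unique =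
    t≢0 (sym (ℕₚ.suc-injective (ℤₚ.+-injective
      (trans (sym one) (trans (sym (sum-single _ N others)) (triad-centers A∥B s≡t² A∥C B∥C))))))
    where
    one : meet C N * transversal A∥B N ≡ 1ℤ
    one = cong₂ _*_ (meet-concurrent (λ { refl → A∥C a aA aN }) cC cN)
      (cong₂ _*_ (meet-concurrent (λ { refl → A∥B b bN bB }) aA aN)
                 (meet-concurrent (λ { refl → A∥B a aA aN }) bB bN))
    others : ∀ S → S ≢ N → meet C S * transversal A∥B S ≡ 0ℤ
    others S S≢N with meets? A S | meets? B S | meets? C S
    ... | inj₁ (_ , aA , aS) | inj₁ (_ , bB , bS) | inj₁ (_ , cC , cS) =
      ⊥-elim (S≢N (unique aA aS bB bS cC cS))
    ... | inj₂ dis | _ | _ =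
      trans (cong (λ m → meet C S * (m * meet B S)) (meet-disjoint dis)) (ℤₚ.*-zeroʳ (meet C S))
    ... | inj₁ _ | inj₂ dis | _ =
      trans (cong (λ m → meet C S * (meet A S * m)) (meet-disjoint dis))
            (trans (cong (meet C S *_) (ℤₚ.*-zeroʳ (meet A S))) (ℤₚ.*-zeroʳ (meet C S)))
    ... | inj₁ _ | inj₁ _ | inj₂ dis = cong (_* transversal A∥B S) (meet-disjoint dis)

  -- Each of the t + 1 lines on `a` carries exactly one point collinear with `b`.
  count-perp : ∀ {a b} → col I a b ≡ false → count (perp I a b) ≡ suc t
  count-perp {a} {b} a≁b = ℤₚ.+-injective (begin
    + count (perp I a b)
      ≡⟨ count≡sum (perp I a b) ⟩
    ∑[ q < nP ] ⟦ perp I a b q ⟧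
      ≡⟨ sum-cong-≗ joined ⟩
    ∑[ q < nP ] (join a q * ⟦ col I b q ⟧)
      ≡⟨ sym (∑-assoc (incid a) (λ L q → incid q L) (λ q → ⟦ col I b q ⟧)) ⟩
    ∑[ L < nL ] (incid a L * ∑[ q < nP ] (incid q L * ⟦ col I b q ⟧))
      ≡⟨ sum-cong-≗ projected ⟩
    ∑[ L < nL ] incid a L
      ≡⟨ ∑-incid-point a ⟩
    + suc t ∎)
    where
    -- The weight `join a q` exceeds 1 only at `q` = `a`, where the other factor is 0 because `a`
    -- and `b` are not collinear.
    joined : ∀ q → ⟦ perp I a b q ⟧ ≡ join a q * ⟦ col I b q ⟧
    joined q with a ≟ q
    ... | no ne = trans (⟦⟧-∧ (col I a q) (col I b q)) (cong (_* ⟦ col I b q ⟧) (sym (join-≢ ne)))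
    ... | yes refl with col I b a in e
    ...   | true  = ⊥-elim (false≢true (trans (sym a≁b) (~-sym e)))
    ...   | false = trans (⟦⟧-∧ (col I a a) false)
                          (trans (ℤₚ.*-zeroʳ ⟦ col I a a ⟧) (sym (ℤₚ.*-zeroʳ (join a a))))
    projected : ∀ L → incid a L * ∑[ q < nP ] (incid q L * ⟦ col I b q ⟧) ≡ incid a L
    projected L with I a L in aL | I b L in bL
    ... | false | _     = refl
    ... | true  | true  = ⊥-elim (false≢true (trans (sym a≁b) (~-intro L aL bL)))
    ... | true  | false = trans (ℤₚ.*-identityˡ _)
      (trans (sum-cong-≗ λ q → sym (⟦⟧-∧ (I q L) (col I b q)))
      (trans (sym (count≡sum (λ q → I q L ∧ col I b q))) (cong +_ (gqAxiom b L bL))))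

-- Elations fixing two lines on x pointwise.

module Elation {nP nL : ℕ} (I : Fin nP → Fin nL → Bool) {s t : ℕ} (x : Fin nP) (H : Aut I → Set)
               (egq : IsEGQ I s t x H) (star : PropertyStar I x H)
               (s≡t² : s ≡ t ℕ.* t) {t′ : ℕ} (t≡ : t ≡ suc t′) {s′ : ℕ} (s≡ : s ≡ suc s′) where
  open IsEGQ egq
  open IsSubgroup subgroup
  open Quadrangle I gq

  pf-injective : ∀ (h : Aut I) {p q} → pf h p ≡ pf h q → p ≡ q
  pf-injective h {p} {q} e = trans (sym (pgf h p)) (trans (cong (pg h) e) (pgf h q))

  lf-injective : ∀ (h : Aut I) {L M} → lf h L ≡ lf h M → L ≡ M
  lf-injective h {L} {M} e = trans (sym (lgf h L)) (trans (cong (lg h) e) (lgf h M))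

  ∈-image : ∀ (h : Aut I) {p L} → p ∈ L → pf h p ∈ lf h L
  ∈-image h {p} {L} pL = trans (inc h p L) pL

  ~-image : ∀ (h : Aut I) {p q} → p ~ q → pf h p ~ pf h q
  ~-image h c = let L , pL , qL = ~-elim c in ~-intro (lf h L) (∈-image h pL) (∈-image h qL)

  ∈-fixed : ∀ {h} → H h → ∀ {p L} → x ∈ L → p ∈ L → pf h p ∈ L
  ∈-fixed {h} Hh {p} {L} xL pL = subst (pf h p ∈_) (fixLines h Hh L xL) (∈-image h pL)

  FixesPointwise : Aut I → Fin nL → Set
  FixesPointwise h L = ∀ p → p ∈ L → pf h p ≡ p

  -- A fixed line off x would contain the projection of a fixed point of M, a fixed point opposite x.
  no-fixed-line : ∀ h → (∀ q → col I x q ≡ false → pf h q ≢ q) →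
    ∀ {L M S v} → x ∈ L → x ∈ M → L ≢ M → FixesPointwise h M →
    x ∉ S → v ∈ L → v ∈ S → lf h S ≢ S
  no-fixed-line h moves {L} {M} {S} {v} xL xM L≢M fixM xS vL vS hS
    with another-point s≡ M x
  ... | z , zM , z≢x = moves q (¬-not x≁q) hq
    where
    v∉M : v ∉ M
    v∉M = ∉-intro λ vM → false≢true (trans (sym xS) (subst (_∈ S) (same-point L≢M vL vM xL xM) vS))
    z∉S : z ∉ S
    z∉S = ∉-intro λ zS → z≢x (no-triangle v∉M zM xM (~-intro S vS zS) (~-intro L vL xL))
    proj = project z∉S
    q = proj₁ proj
    qS = proj₁ (proj₂ proj)
    zq = proj₂ (proj₂ proj)
    -- If `x` and `q` were collinear, then `q` = `v`, and `v` would be collinear with both `z` and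
    -- `x` on `M`.
    x≁q : ¬ (x ~ q)
    x≁q xq = z≢x (no-triangle v∉M zM xM (~-sym (subst (z ~_) q≡v zq)) (~-intro L vL xL))
      where q≡v = no-triangle xS qS vS xq (~-intro L xL vL)
    hq : pf h q ≡ q
    hq = no-triangle z∉S (subst (pf h q ∈_) hS (∈-image h qS)) qS
           (subst (_~ pf h q) (fixM z zM) (~-image h zq)) zq

  -- If r on N is moved and R ≠ N is a line on r, then N is the only center of the triad R, hR, L.
  two-fixed-lines⇒symmetry : ∀ {h} → H h → (∀ q → col I x q ≡ false → pf h q ≢ q) →
    ∀ {L M} → x ∈ L → x ∈ M → L ≢ M → FixesPointwise h L → FixesPointwise h M → IsSymmetry I x h
  two-fixed-lines⇒symmetry {h} Hh moves {L} {M} xL xM L≢M fixL fixM r xr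
    with pf h r ≟ r | ~-elim xr
  ... | yes e | _ = e
  ... | no moved | N , xN , rN with another-line t≡ r N
  ...   | R , rR , R≢N = ⊥-elim (unique-center⇒⊥ s≡t² (λ t≡0 → ℕₚ.0≢1+n (trans (sym t≡0) t≡)) N
            R∥hR R∥L hR∥L (r , rR , rN) (pf h r , hrhR , hrN) (x , xL , xN) center)
    where
    hx : pf h x ≡ x
    hx = fixL x xL
    r≢x : r ≢ x
    r≢x refl = moved hx
    hr≢x : pf h r ≢ x
    hr≢x e = r≢x (pf-injective h (trans e (sym hx)))
    hrN = ∈-fixed Hh xN rN
    hrhR = ∈-image h rR
    hR≢N : lf h R ≢ N
    hR≢N e = R≢N (lf-injective h (trans e (sym (fixLines h Hh N xN))))
    L≢N : L ≢ N
    L≢N refl = moved (fixL r rN)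
    R∥hR : Disjoint R (lf h R)
    R∥hR = disjoint-on-line (moved ∘ sym) rN hrN rR hrhR R≢N hR≢N
    R∥L : Disjoint R L
    R∥L = disjoint-on-line r≢x rN xN rR xL R≢N L≢N
    hR∥L : Disjoint (lf h R) L
    hR∥L = disjoint-on-line hr≢x hrN xN hrhR xL hR≢N L≢N
    x∉R : x ∉ R
    x∉R = ∉-intro λ xR → R∥L x xR xL
    center : ∀ {S a b c} → a ∈ R → a ∈ S → b ∈ lf h R → b ∈ S → c ∈ L → c ∈ S → S ≡ N
    center {S} {a} {b} {c} aR aS bhR bS cL cS with c ≟ x
    -- Here S passes through `x`. The projection of `x` onto `R` is `r`, so `a` = `r` and S is the
    -- line joining `x` and `r`.
    ... | yes refl = same-line (r≢x ∘ sym) cS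
            (subst (_∈ S) (no-triangle x∉R aR rR (~-intro S cS aS) (~-intro N xN rN)) aS) xN rN
    ... | no c≢x = ⊥-elim (no-fixed-line h moves xL xM L≢M fixM x∉S cL cS hS)
      where
      x∉S : x ∉ S
      x∉S = ∉-intro λ xS → R∥L a aR (subst (a ∈_) (same-line c≢x cS xS cL xL) aS)
      -- Both points are the projection onto `lf h R` of the fixed point `c`.
      ha≡b : pf h a ≡ b
      ha≡b = no-triangle (∉-intro λ chR → hR∥L c chR cL) (∈-image h aR) bhR
        (subst (_~ pf h a) (fixL c cL) (~-image h (~-intro S cS aS))) (~-intro S cS bS)
      hS : lf h S ≡ S
      hS = same-line {c} {b} (λ { refl → hR∥L c bhR cL })
        (subst (_∈ lf h S) (fixL c cL) (∈-image h cS))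
        (subst (_∈ lf h S) ha≡b (∈-image h aS)) cS bS

  -- The set {a,b}^⊥, the group of symmetries and regularity.

  module _ {L M a b} (xL : x ∈ L) (xM : x ∈ M) (L≢M : L ≢ M)
           (aL : a ∈ L) (bM : b ∈ M) (a≢x : a ≢ x) (b≢x : b ≢ x) where

    a∉M : a ∉ M
    a∉M = ∉-intro λ aM → a≢x (same-point L≢M aL aM xL xM)

    b∉L : b ∉ L
    b∉L = ∉-intro λ bL → b≢x (same-point L≢M bL bM xL xM)

    a≁b : col I a b ≡ false
    a≁b = ¬-not λ ab → b≢x (no-triangle a∉M bM xM ab (~-intro L aL xL))

    x∈perp : perp I a b x ≡ true
    x∈perp = ∧-intro (~-intro L aL xL) (~-intro M bM xM)

    -- If `w` were collinear with `x`, there would be a triangle: `b`, `w`, `x` for `w` on `L`, and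
    -- `w`, `a`, `x` otherwise.
    perp-opposite : ∀ {w} → perp I a b w ≡ true → w ≢ x → col I x w ≡ false
    perp-opposite {w} pw w≢x = ¬-not x≁w
      where
      aw = ∧-conicalˡ _ _ pw
      bw = ∧-conicalʳ (col I a w) _ pw
      x≁w : ¬ (x ~ w)
      x≁w xw with I w L in wL
      ... | true  = w≢x (no-triangle b∉L wL xL bw (~-intro M bM xM))
      ... | false = a≢x (no-triangle wL aL xL (~-sym aw) (~-sym xw))

    -- Both `c` and its image are the projection of `pf h w` onto `K`, so `c` is fixed and property
    -- (*) applies.
    fixes : ∀ {h} → H h → ∀ {c K w} → x ∈ K → c ∈ K → c ≢ x → col I x (pf h w) ≡ false →
            c ~ w → c ~ pf h w → FixesPointwise h K
    fixes {h} Hh {c} {K} {w} xK cK c≢x x≁hw cw chw z zK =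
      star h Hh c c≢x (~-intro K xK cK)
        (no-triangle (∉-intro λ hwK → false≢true (trans (sym x≁hw) (~-intro K xK hwK)))
          (∈-fixed Hh xK cK) cK (~-sym (~-image h cw)) (~-sym chw))
        K xK cK z zK

    perp-symmetry : ∀ {w₀ w} → perp I a b w₀ ≡ true → w₀ ≢ x → perp I a b w ≡ true → w ≢ x →
                    Σ (Aut I) λ h → H h × pf h w₀ ≡ w × IsSymmetry I x h
    perp-symmetry {w₀} {w} p₀ w₀≢x p w≢x
      with transitive w₀ w (perp-opposite p₀ w₀≢x) (perp-opposite p w≢x)
    ... | h , Hh , refl = h , Hh , refl , symmetry
      where
      x≁w₀ = perp-opposite p₀ w₀≢x
      x≁w = perp-opposite p w≢x
      fixL : FixesPointwise h L
      fixL = fixes Hh xL aL a≢x x≁w (∧-conicalˡ _ _ p₀) (∧-conicalˡ _ _ p)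
      fixM : FixesPointwise h M
      fixM = fixes Hh xM bM b≢x x≁w (∧-conicalʳ (col I a w₀) _ p₀) (∧-conicalʳ (col I a w) _ p)
      symmetry : IsSymmetry I x h
      -- By sharpness `h` is the identity as soon as it fixes a point opposite `x`; otherwise it
      -- moves all such points, as `two-fixed-lines⇒symmetry` requires.
      symmetry with pf h w₀ ≟ w₀
      ... | yes e = λ q _ → proj₁ (sharp w₀ h (idA I) x≁w₀ Hh hasId e) q
      ... | no ne = two-fixed-lines⇒symmetry Hh
        (λ q x≁q e → ne (proj₁ (sharp q h (idA I) x≁q Hh hasId e) w₀)) xL xM L≢M fixL fixM

    perp-image : ∀ {h} → IsSymmetry I x h → ∀ {w} → perp I a b w ≡ true → perp I a b (pf h w) ≡ true
    perp-image {h} sym-h {w} p = ∧-intro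
      (subst (_~ pf h w) (sym-h a (~-intro L xL aL)) (~-image h (∧-conicalˡ _ _ p)))
      (subst (_~ pf h w) (sym-h b (~-intro M xM bM)) (~-image h (∧-conicalʳ (col I a w) _ p)))

    -- The t symmetries are indexed by the t points of {a,b}^⊥ other than `x`: `θ i` takes the base
    -- point `w₀` to `w i`.
    symmetry-group : IsSTGQ I s t x H
    symmetry-group = egq , θ , (λ i → proj₁ (proj₂ (elation i))) , θ-symmetry , θ-injective ,
      (base , θ-base) , θ-closed , θ-inverse
      where
      open Enumeration (enumerate (perp I a b) (count-perp a≁b))
      ix : Fin (suc t)
      ix = index x x∈perp

      -- `punchIn ix` skips the index of `x` among the t + 1 points.
      w : Fin t → Fin nP
      w i = at (punchIn ix i)

      w-perp : ∀ i → perp I a b (w i) ≡ true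
      w-perp i = sound (punchIn ix i)

      w≢x : ∀ i → w i ≢ x
      w≢x i e = punchInᵢ≢i ix i (injective _ _ (trans e (sym (at-index x x∈perp))))

      w-surjective : ∀ q → perp I a b q ≡ true → q ≢ x → ∃ λ k → w k ≡ q
      w-surjective q pq q≢x = punchOut ix≢ , trans (cong at (punchIn-punchOut ix≢)) (at-index q pq)
        where
        ix≢ : ix ≢ index q pq
        ix≢ e = q≢x (trans (sym (at-index q pq)) (trans (cong at (sym e)) (at-index x x∈perp)))

      base : Fin t
      base = subst Fin (sym t≡) zero

      w₀ : Fin nP
      w₀ = w base

      x≁w₀ : col I x w₀ ≡ false
      x≁w₀ = perp-opposite (w-perp base) (w≢x base)

      elation : ∀ i → Σ (Aut I) λ h → H h × pf h w₀ ≡ w i × IsSymmetry I x h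
      elation i = perp-symmetry (w-perp base) (w≢x base) (w-perp i) (w≢x i)

      θ : Fin t → Aut I
      θ i = proj₁ (elation i)

      θ∈H : ∀ i → H (θ i)
      θ∈H i = proj₁ (proj₂ (elation i))

      θ-w₀ : ∀ i → pf (θ i) w₀ ≡ w i
      θ-w₀ i = proj₁ (proj₂ (proj₂ (elation i)))

      θ-symmetry : ∀ i → IsSymmetry I x (θ i)
      θ-symmetry i = proj₂ (proj₂ (proj₂ (elation i)))

      x~x : x ~ x
      x~x = ~-intro L xL xL

      -- A symmetry in `H` preserves {a,b}^⊥ and fixes `x`, so it takes `w₀` to some `w k`;
      -- sharpness identifies it with `θ k`. Closure under composition and inversion follows.
      index-of : ∀ g → H g → IsSymmetry I x g → Σ (Fin t) λ k → _≈A_ I g (θ k)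
      index-of g Hg sym-g =
        let k , e = w-surjective (pf g w₀) (perp-image {g} sym-g (w-perp base))
                      λ e → w≢x base (pf-injective g (trans e (sym (sym-g x x~x))))
        in k , sharp w₀ g (θ k) x≁w₀ Hg (θ∈H k) (trans (sym e) (sym (θ-w₀ k)))

      θ-injective : ∀ i j → _≈A_ I (θ i) (θ j) → i ≡ j
      θ-injective i j e = punchIn-injective ix i j (injective _ _
        (trans (sym (θ-w₀ i)) (trans (proj₁ e w₀) (θ-w₀ j))))

      θ-base : _≈A_ I (θ base) (idA I)
      θ-base = sharp w₀ (θ base) (idA I) x≁w₀ (θ∈H base) hasId (θ-w₀ base)

      θ-closed : ∀ i j → Σ (Fin t) λ k → _≈A_ I (_∘A_ I (θ i) (θ j)) (θ k)
      θ-closed i j = index-of _ (closedComp _ _ (θ∈H i) (θ∈H j))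
        λ p xp → trans (cong (pf (θ i)) (θ-symmetry j p xp)) (θ-symmetry i p xp)

      θ-inverse : ∀ i → Σ (Fin t) λ k → _≈A_ I (invA I (θ i)) (θ k)
      θ-inverse i = index-of _ (closedInv _ (θ∈H i))
        λ p xp → trans (cong (pg (θ i)) (sym (θ-symmetry i p xp))) (pgf (θ i) p)

    -- One inclusion holds because `a` and `b` lie in {x,y}^⊥. For the other, a symmetry takes `y`
    -- to any `q` of {a,b}^⊥ other than `x` and fixes each `w` of {x,y}^⊥, so collinearity of `w`
    -- with `y` passes to `q`.
    perpperp≡perp : ∀ {y} → col I x y ≡ false → y ~ a → y ~ b → perpperp I x y ≗ perp I a b
    perpperp≡perp {y} x≁y ya yb q = ⇔⇒≡ to from
      where
      perpperp-elim : perpperp I x y q ≡ true → ∀ w → x ~ w → y ~ w → w ~ q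
      perpperp-elim h w xw yw with allF⇒∀ (λ w → not (perp I x y w) ∨ col I w q) h w
      ... | r rewrite xw | yw = r

      to : perpperp I x y q ≡ true → perp I a b q ≡ true
      to h = ∧-intro (perpperp-elim h a (~-intro L xL aL) ya) (perpperp-elim h b (~-intro M xM bM) yb)

      y≢x : y ≢ x
      y≢x refl = false≢true (trans (sym x≁y) (~-intro L xL xL))

      ~-perp : perp I a b q ≡ true → ∀ w → x ~ w → y ~ w → w ~ q
      ~-perp pq w xw yw with q ≟ x
      ... | yes refl = ~-sym xw
      ... | no q≢x with perp-symmetry (∧-intro (~-sym ya) (~-sym yb)) y≢x pq q≢x
      ...   | h , _ , refl , sym-h = ~-sym (subst (pf h y ~_) (sym-h w xw) (~-image h yw))

      implies : ∀ p c → (p ≡ true → c ≡ true) → not p ∨ c ≡ true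
      implies true  c f = f refl
      implies false c f = refl

      from : perp I a b q ≡ true → perpperp I x y q ≡ true
      from pq = ∀⇒allF _ λ w → implies (perp I x y w) (col I w q) λ h →
        ~-perp pq w (∧-conicalˡ _ _ h) (∧-conicalʳ (col I x w) _ h)

  stgq : IsSTGQ I s t x H
  stgq =
    let L , xL = line-through x
        M , xM , M≢L = another-line t≡ x L
        a , aL , a≢x = another-point s≡ L x
        b , bM , b≢x = another-point s≡ M x
    in symmetry-group xL xM (M≢L ∘ sym) aL bM a≢x b≢x

  regular : IsRegular I t x
  regular y x≁y =
    let L , xL = line-through x
        M , xM , M≢L = another-line t≡ x L
        a , aL , ya = project (y∉ xL)
        b , bM , yb = project (y∉ xM)
    in trans (count-cong (perpperp≡perp xL xM (M≢L ∘ sym) aL bM (≢x ya) (≢x yb) x≁y ya yb))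
             (count-perp (a≁b xL xM (M≢L ∘ sym) aL bM (≢x ya) (≢x yb)))
    where
    ≢x : ∀ {c} → y ~ c → c ≢ x
    ≢x yc refl = false≢true (trans (sym x≁y) (~-sym yc))
    y∉ : ∀ {K} → x ∈ K → y ∉ K
    y∉ xK = ∉-intro λ yK → false≢true (trans (sym x≁y) (~-intro _ xK yK))

open import Data.Nat using (_*_; _≤_)

mainTheorem8 : ∀ {nP nL : ℕ} (I : Fin nP → Fin nL → Bool) (t : ℕ)
    (x : Fin nP) (H : Aut I → Set) →
    2 ≤ t → 2 ≤ t * t →
    IsEGQ I (t * t) t x H →
    PropertyStar I x H →
    IsSTGQ I (t * t) t x H × IsRegular I t x
mainTheorem8 I (suc t′) x H _ _ egq star = stgq , regular
  -- With t = `suc t′` the product t * t reduces to a successor, so all three equations hold by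
  -- `refl`.
  where open Elation I x H egq star refl refl refl
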